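{- Let $a\ge2$ and $F=\breve F(a,a,a)$, with elements $x_1,\dots,x_{3a-1}$. Then, as functions on $\mathcal J(F)$, \begin{multline*} \chi_{x_a}-\chi_{x_{2a}}=\sum_{i=1}^{a}(-iT_i)-(a-1)T_{2a}+\sum_{i=1}^{a-1}(-iT_{3a-i})\\+\sum_{i=1}^{a-1}\sum_{j=0}^i aT_{\{i,2a+j\}}+\sum_{j=1}^{a-1}aT_{\{a,2a+j\}}+\sum_{i=1}^{a-1}(-aT_{\{i,2a-i,2a+i\}}). \end{multline*}
   Context: The fence $\breve F(a,a,a)$ is the poset on $\{x_1,\dots,x_{3a-1}\}$ with cover relations $x_1\lessdot x_2\lessdot\dots\lessdot x_a$, $x_a\gtrdot x_{a+1}\gtrdot\dots\gtrdot x_{2a}$, $x_{2a}\lessdot x_{2a+1}\lessdot\dots\lessdot x_{3a-1}$. $\mathcal J(F)$ is the set of order ideals. $\chi_q(I)=1$ if $q\in\max(I)$, else $0$. For an antichain $A\subseteq F$ the antichain toggleability statistic is $T_A(I)=1$ if $A\subseteq\min(F\setminus I)$, $-1$ if $A\subseteq\max(I)$, and $0$ otherwise. Notation: $T_i=T_{\{x_i\}}$, and $T_{\{i,j\}}=T_{\{x_i,x_j\}}$, $T_{\{i,j,k\}}=T_{\{x_i,x_j,x_k\}}$ (these index sets are antichains). -}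

module Defs where

open import Data.Bool using (if_then_else_)
open import Data.Fin using (Fin; toℕ; fromℕ<)
open import Data.Fin.Properties using (toℕ-injective; toℕ-fromℕ<; toℕ<n; all?)
  renaming (_≟_ to _≟ᶠ_)
open import Data.Fin.Subset using (Subset; _∈_; _⊆_; ∁)
open import Data.Fin.Subset.Properties using (_∈?_; _⊆?_)
open import Data.Integer using (ℤ; 0ℤ; 1ℤ; -1ℤ)
open import Data.Integer.Properties using () renaming (+-*-semiring to ℤ-semiring)
open import Data.List using (List)
open import Data.List.Membership.DecPropositional using () renaming (_∈?_ to memberℕ?)
open import Data.Nat using (ℕ; zero; suc; pred; _+_; _*_; _∸_; _≤_; _<_; z≤n; s≤s; _≤?_; _≟_)
open import Data.Nat.Properties
open import Data.Product using (_×_; _,_; ∃)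
open import Data.Sum using (_⊎_; inj₁; inj₂)
open import Data.Vec using (tabulate)
open import Level using (0ℓ)
open import Relation.Binary.Core using (Rel)
open import Relation.Binary.Definitions using (Decidable; Antisymmetric)
open import Relation.Binary.PropositionalEquality
open import Relation.Binary.Structures using (IsDecPartialOrder)
open import Relation.Binary.Construct.Closure.ReflexiveTransitive using (Star; ε; _◅_; _◅◅_)
open import Relation.Nullary.Decidable
  using (Dec; does; map′; _×-dec_; _⊎-dec_; _→-dec_; recompute)
open import Algebra.Properties.Semiring.Sum ℤ-semiring using (sum)

module Ideals {n} {_≼_ : Rel (Fin n) 0ℓ} (P : IsDecPartialOrder _≡_ _≼_) where

  open IsDecPartialOrder P using () renaming (_≤?_ to _≼?_)

  record 𝒥 : Set where
    field
      ideal  : Subset n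
      closed : ∀ {p q} → p ≼ q → q ∈ ideal → p ∈ ideal

  open 𝒥 public

  IsMaximal IsMinimal : Subset n → Fin n → Set
  IsMaximal S p = p ∈ S × (∀ q → q ∈ S → p ≼ q → q ≡ p)
  IsMinimal S p = p ∈ S × (∀ q → q ∈ S → q ≼ p → q ≡ p)

  isMaximal? : ∀ S p → Dec (IsMaximal S p)
  isMaximal? S p = (p ∈? S) ×-dec
    all? (λ q → (q ∈? S) →-dec ((p ≼? q) →-dec (q ≟ᶠ p)))

  isMinimal? : ∀ S p → Dec (IsMinimal S p)
  isMinimal? S p = (p ∈? S) ×-dec
    all? (λ q → (q ∈? S) →-dec ((q ≼? p) →-dec (q ≟ᶠ p)))

  max min : Subset n → Subset n
  max S = tabulate (λ p → does (isMaximal? S p))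
  min S = tabulate (λ p → does (isMinimal? S p))

  χ : Fin n → 𝒥 → ℤ
  χ q I = if does (q ∈? max (ideal I)) then 1ℤ else 0ℤ

  -- Meaningful for nonempty antichains A, for which the first two cases
  -- exclude each other; the formula makes sense for every subset.
  toggleability : Subset n → 𝒥 → ℤ
  toggleability A I =
    if does (A ⊆? min (∁ (ideal I))) then 1ℤ
    else if does (A ⊆? max (ideal I)) then -1ℤ
    else 0ℤ

-- Elements of the fence are x₁, …, x₃ₐ₋₁; Fin counts from 0.
label : ∀ {n} → Fin n → ℕ
label p = suc (toℕ p)

infix 4 _⊢_⋖_ _⊢_≼_ _⊢_⊑_

-- a ⊢ p ⋖ q : p is covered by q in F̆(a,a,a).
data _⊢_⋖_ (a : ℕ) (p q : Fin (3 * a ∸ 1)) : Set where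
  rise₁ : label q ≡ suc (label p) → label q ≤ a → a ⊢ p ⋖ q
  fall  : label p ≡ suc (label q) → a ≤ label q → label p ≤ 2 * a → a ⊢ p ⋖ q
  rise₂ : label q ≡ suc (label p) → 2 * a ≤ label p → a ⊢ p ⋖ q

_⊢_≼_ : (a : ℕ) → Rel (Fin (3 * a ∸ 1)) 0ℓ
a ⊢ p ≼ q = Star (a ⊢_⋖_) p q

-- An explicit description of the order, used only to see that it is a
-- decidable partial order.
_⊢_⊑_ : (a : ℕ) → Rel (Fin (3 * a ∸ 1)) 0ℓ
a ⊢ p ⊑ q = (label p ≤ label q × label q ≤ a)
          ⊎ (a ≤ label q × label q ≤ label p × label p ≤ 2 * a)
          ⊎ (2 * a ≤ label p × label p ≤ label q)

module _ {a : ℕ} where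

  private
    F : Set
    F = Fin (3 * a ∸ 1)

    a≤2a : a ≤ 2 * a
    a≤2a = m≤m+n a (a + 0)

    2a≤a⇒a≡0 : 2 * a ≤ a → a ≡ 0
    2a≤a⇒a≡0 le = n≤0⇒n≡0 (≤-trans (m≤m+n a 0)
      (+-cancelˡ-≤ a (a + 0) 0 (subst (2 * a ≤_) (sym (+-identityʳ a)) le)))

    1≤label : (p : F) → 0 < label p
    1≤label p = s≤s z≤n

    absurd : {A : Set} (p : F) → 2 * a ≤ label p → label p ≤ a → A
    absurd p u v with ≤-trans (1≤label p) (subst (label p ≤_) (2a≤a⇒a≡0 (≤-trans u v)) v)
    ... | ()

    label-injective : {p q : F} → label p ≡ label q → p ≡ q
    label-injective eq = toℕ-injective (suc-injective eq)

  ⊑-refl : {p : F} → a ⊢ p ⊑ p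
  ⊑-refl {p} with ≤-total (label p) a | ≤-total (label p) (2 * a)
  ... | inj₁ u | _      = inj₁ (≤-refl , u)
  ... | inj₂ u | inj₁ v = inj₂ (inj₁ (u , ≤-refl , v))
  ... | inj₂ _ | inj₂ v = inj₂ (inj₂ (v , ≤-refl))

  private
    ⋖⇒≤ : {m n : ℕ} → n ≡ suc m → m ≤ n
    ⋖⇒≤ {m} refl = n≤1+n m

  ⋖-⊑-trans : {p q r : F} → a ⊢ p ⋖ q → a ⊢ q ⊑ r → a ⊢ p ⊑ r
  ⋖-⊑-trans (rise₁ e u) (inj₁ (v , w)) = inj₁ (≤-trans (⋖⇒≤ e) v , w)
  ⋖-⊑-trans {p} {q} {r} (rise₁ e u) (inj₂ (inj₁ (v , w , _))) =
    inj₁ (subst (label p ≤_) (≤-antisym (≤-trans u v) w) (⋖⇒≤ e) , ≤-trans w u)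
  ⋖-⊑-trans {q = q} (rise₁ e u) (inj₂ (inj₂ (v , _))) = absurd q v u
  ⋖-⊑-trans {p} {q} {r} (fall e u v) (inj₁ (w , z)) =
    inj₂ (inj₁ (≤-trans u w , ≤-trans (≤-trans z u) (⋖⇒≤ e) , v))
  ⋖-⊑-trans (fall e u v) (inj₂ (inj₁ (w , z , _))) =
    inj₂ (inj₁ (w , ≤-trans z (⋖⇒≤ e) , v))
  ⋖-⊑-trans {p} {q} (fall e u v) (inj₂ (inj₂ (w , _))) with
    ≤-trans (≤-reflexive (sym e)) (≤-trans v w)
  ... | z with 1+n≰n z
  ... | ()
  ⋖-⊑-trans {p} {q} (rise₂ e u) (inj₁ (v , w)) =
    absurd q (≤-trans u (⋖⇒≤ e)) (≤-trans v w)
  ⋖-⊑-trans {p} {q} (rise₂ e u) (inj₂ (inj₁ (v , w , z))) with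
    ≤-trans (≤-reflexive (sym e)) (≤-trans z u)
  ... | y with 1+n≰n y
  ... | ()
  ⋖-⊑-trans (rise₂ e u) (inj₂ (inj₂ (v , w))) = inj₂ (inj₂ (u , ≤-trans (⋖⇒≤ e) w))

  ≼⇒⊑ : {p q : F} → a ⊢ p ≼ q → a ⊢ p ⊑ q
  ≼⇒⊑ ε        = ⊑-refl
  ≼⇒⊑ (c ◅ cs) = ⋖-⊑-trans c (≼⇒⊑ cs)

  private
    next : (p q : F) → label p < label q → ∃ λ (r : F) → label r ≡ suc (label p)
    next p q (s≤s lt) = fromℕ< bound , cong suc (toℕ-fromℕ< bound)
      where bound = ≤-<-trans lt (toℕ<n q)

    split : {m n : ℕ} (d : ℕ) → n ≡ m + suc d → m < n × n ≡ suc m + d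
    split {m} d e = subst (m <_) (sym e) (m<m+n m (s≤s z≤n)) , trans e (+-suc m d)

    climb₁ : ∀ d (p q : F) → label q ≡ label p + d → label q ≤ a → a ⊢ p ≼ q
    climb₁ zero p q e u with label-injective {p} {q} (sym (trans e (+-identityʳ _)))
    ... | refl = ε
    climb₁ (suc d) p q e u with split d e
    ... | lt , e′ with next p q lt
    ... | r , er = rise₁ er (≤-trans (≤-trans (≤-reflexive er) lt) u)
                 ◅ climb₁ d r q (trans e′ (cong (_+ d) (sym er))) u

    climb₂ : ∀ d (p q : F) → label q ≡ label p + d → 2 * a ≤ label p → a ⊢ p ≼ q
    climb₂ zero p q e u with label-injective {p} {q} (sym (trans e (+-identityʳ _)))
    ... | refl = ε
    climb₂ (suc d) p q e u with split d e
    ... | lt , e′ with next p q lt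
    ... | r , er = rise₂ er u
                 ◅ climb₂ d r q (trans e′ (cong (_+ d) (sym er)))
                     (≤-trans u (⋖⇒≤ er))

    descend : ∀ d (p q : F) → label p ≡ label q + d → a ≤ label q → label p ≤ 2 * a →
              a ⊢ p ≼ q
    descend zero p q e u v with label-injective {p} {q} (trans e (+-identityʳ _))
    ... | refl = ε
    descend (suc d) p q e u v with split d e
    ... | lt , e′ with next q p lt
    ... | r , er = descend d p r (trans e′ (cong (_+ d) (sym er)))
                     (≤-trans u (⋖⇒≤ er)) v
                 ◅◅ (fall er u (≤-trans (≤-trans (≤-reflexive er) lt) v) ◅ ε)

  ⊑⇒≼ : {p q : F} → a ⊢ p ⊑ q → a ⊢ p ≼ q
  ⊑⇒≼ {p} {q} (inj₁ (u , v)) = climb₁ _ p q (sym (m+[n∸m]≡n u)) v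
  ⊑⇒≼ {p} {q} (inj₂ (inj₁ (u , v , w))) = descend _ p q (sym (m+[n∸m]≡n v)) u w
  ⊑⇒≼ {p} {q} (inj₂ (inj₂ (u , v))) = climb₂ _ p q (sym (m+[n∸m]≡n v)) u

  ⊑-antisym : {p q : F} → a ⊢ p ⊑ q → a ⊢ q ⊑ p → p ≡ q
  ⊑-antisym {p} {q} x y = label-injective (go x y)
    where
    go : a ⊢ p ⊑ q → a ⊢ q ⊑ p → label p ≡ label q
    go (inj₁ (u , v)) (inj₁ (w , z)) = ≤-antisym u w
    go (inj₁ (u , v)) (inj₂ (inj₁ (w , z , _))) = ≤-antisym u (≤-trans v w)
    go (inj₁ (u , v)) (inj₂ (inj₂ (w , z))) = ≤-antisym u z
    go (inj₂ (inj₁ (u , v , w))) (inj₁ (z , t)) = ≤-antisym (≤-trans t u) v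
    go (inj₂ (inj₁ (u , v , w))) (inj₂ (inj₁ (z , t , _))) = ≤-antisym t v
    go (inj₂ (inj₁ (u , v , w))) (inj₂ (inj₂ (z , t))) = ≤-antisym (≤-trans w z) v
    go (inj₂ (inj₂ (u , v))) (inj₁ (w , z)) = ≤-antisym v w
    go (inj₂ (inj₂ (u , v))) (inj₂ (inj₁ (w , z , t))) = ≤-antisym v (≤-trans t u)
    go (inj₂ (inj₂ (u , v))) (inj₂ (inj₂ (w , z))) = ≤-antisym v z

  ⊑? : Decidable (a ⊢_⊑_)
  ⊑? p q = ((label p ≤? label q) ×-dec (label q ≤? a))
    ⊎-dec (((a ≤? label q) ×-dec ((label q ≤? label p) ×-dec (label p ≤? 2 * a)))
    ⊎-dec ((2 * a ≤? label p) ×-dec (label p ≤? label q)))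

fence : (a : ℕ) → IsDecPartialOrder _≡_ (a ⊢_≼_)
fence a = record
  { isPartialOrder = record
    { isPreorder = record
      { isEquivalence = isEquivalence
      ; reflexive     = λ { refl → ε }
      ; trans         = _◅◅_
      }
    ; antisym = λ x y → ⊑-antisym (≼⇒⊑ x) (≼⇒⊑ y)
    }
  ; _≟_  = _≟ᶠ_
  ; _≤?_ = λ p q → map′ ⊑⇒≼ ≼⇒⊑ (⊑? p q)
  }

module Fence (a : ℕ) where

  open Ideals (fence a) public

  InRange : ℕ → Set
  InRange i = 1 ≤ i × i ≤ 3 * a ∸ 1

  x : (i : ℕ) → .(InRange i) → Fin (3 * a ∸ 1)
  x i r = fromℕ< {pred i} (bound i r)
    where
    bound : ∀ i → .(InRange i) → pred i < 3 * a ∸ 1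
    bound i r with recompute ((1 ≤? i) ×-dec (i ≤? 3 * a ∸ 1)) r
    bound (suc i) r | _ , u = u

  label-x : ∀ i .(r : InRange i) → label (x i r) ≡ i
  label-x zero    r with recompute ((1 ≤? 0) ×-dec (0 ≤? 3 * a ∸ 1)) r
  ... | () , _
  label-x (suc i) r = cong suc (toℕ-fromℕ< _)

  -- The set of all xᵢ with i in the given list; numbers outside 1, …, 3a−1
  -- name no element and contribute nothing.
  x[_] : List ℕ → Subset (3 * a ∸ 1)
  x[ is ] = tabulate (λ p → does (memberℕ? _≟_ (label p) is))

  T : List ℕ → 𝒥 → ℤ
  T is = toggleability x[ is ]

  private
    2a≤3a-1 : 1 ≤ a → 2 * a ≤ 3 * a ∸ 1
    2a≤3a-1 h = ≤-trans (≤-reflexive (sym (m+n∸m≡n 1 (2 * a))))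
                        (∸-monoˡ-≤ 1 (+-monoˡ-≤ (2 * a) h))

  a-inRange : 2 ≤ a → InRange a
  a-inRange h = ≤-trans (n≤1+n 1) h ,
    ≤-trans (m≤m+n a (a + 0)) (2a≤3a-1 (≤-trans (n≤1+n 1) h))

  2a-inRange : 2 ≤ a → InRange (2 * a)
  2a-inRange h = ≤-trans (≤-trans (n≤1+n 1) h) (m≤m+n a (a + 0)) ,
    2a≤3a-1 (≤-trans (n≤1+n 1) h)

-- The sum of f i over m ≤ i ≤ n.
∑-range : ℕ → ℕ → (ℕ → ℤ) → ℤ
∑-range m n f = sum {suc n ∸ m} (λ k → f (m + toℕ k))

infixr 6.5 ∑-range
syntax ∑-range m n (λ i → e) = ∑[ i ≔ m ⋯ n ] e

{-# OPTIONS --safe #-}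
module Submission where

-- Let f, g, m be the indicators of the ideal on the chains x₁ < … < x_a,
-- x_{2a} < … < x_{3a-1} and x_{2a} < … < x_a, each preceded by a formal bottom
-- element.  Since an ideal meets a chain in an initial segment, "xᵢ can be
-- added" and "xᵢ can be removed" are differences of consecutive values of one
-- of these functions, or products of two such differences at x_a and x_{2a}.
-- As T_A is the product of the first indicators over A minus the product of
-- the second, each sum in the theorem telescopes.  What is left is a polynomial
-- identity modulo two vanishing products: x_a and x_{2a} are never both addable,
-- nor both removable.

open import Defs
open import Data.Bool using (true; if_then_else_)
open import Data.Fin using (Fin; toℕ)
open import Data.Fin.Properties using (toℕ<n; toℕ-injective; any?)
open import Data.Fin.Subset using (Subset; _∈_; _⊆_; ∁)
open import Data.Fin.Subset.Properties using (_∈?_; _⊆?_; x∈∁p⇒x∉p; x∉p⇒x∈∁p)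
open import Data.Integer using (ℤ; 0ℤ; 1ℤ; -1ℤ; +_; -_; _+_; _-_; _*_)
import Data.Integer.Properties as ℤ
open import Algebra.Properties.Semiring.Sum ℤ.+-*-semiring using (sum)
open import Data.Integer.Tactic.RingSolver using (solve-∀)
open import Data.Nat as ℕ using (ℕ; zero; suc; _∸_; _≤_; _<_; z≤n; s≤s; z<s)
open import Data.List using (List; []; _∷_)
open import Data.List.Membership.DecPropositional ℕ._≟_ using () renaming (_∈?_ to _∈ˡ?_)
open import Data.List.Membership.Propositional using () renaming (_∈_ to _∈ˡ_)
open import Data.List.Relation.Unary.All as All using (All; []; _∷_)
open import Data.Nat.Properties
open import Data.Product using (_×_; _,_; ∃; proj₁; proj₂)
open import Data.Sum using (_⊎_; inj₁; inj₂)
open import Data.Unit using (⊤; tt)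
open import Data.Vec using (tabulate)
open import Data.Vec.Properties using (lookup∘tabulate; lookup⇒[]=; []=⇒lookup)
open import Function using (_∘_; _⇔_; mk⇔; Equivalence)
open import Relation.Binary.Construct.Closure.ReflexiveTransitive using (ε; _◅_)
open import Relation.Binary.PropositionalEquality using (_≡_; refl; sym; trans; cong; cong₂; subst; module ≡-Reasoning)
open import Relation.Nullary using (¬_; Dec; yes; no; contradiction)
open import Relation.Nullary.Decidable using (does; does-⇔; ¬?; _×-dec_; dec-true)

open Equivalence using (to; from)

-- Integer indicators of decidable propositions.

private variable
  A B C C′ D D′ : Set

⟦_⟧ : Dec A → ℤ
⟦ d ⟧ = if does d then 1ℤ else 0ℤ

⟦⟧-⇔ : (d : Dec A) (e : Dec B) → A ⇔ B → ⟦ d ⟧ ≡ ⟦ e ⟧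
⟦⟧-⇔ (yes a) (yes b) eq = refl
⟦⟧-⇔ (yes a) (no ¬b) eq = contradiction (to eq a) ¬b
⟦⟧-⇔ (no ¬a) (yes b) eq = contradiction (from eq b) ¬a
⟦⟧-⇔ (no ¬a) (no ¬b) eq = refl

⟦⟧-false : (d : Dec A) → ¬ A → ⟦ d ⟧ ≡ 0ℤ
⟦⟧-false (yes a) ¬a = contradiction a ¬a
⟦⟧-false (no _) ¬a = refl

-- The implication `C′ → C` rules out the value -1, so the difference is itself an indicator.
⟦⟧-step : (d : Dec A) (c : Dec C) (c′ : Dec C′) → (C′ → C) → A ⇔ (C × ¬ C′) →
          ⟦ d ⟧ ≡ ⟦ c ⟧ - ⟦ c′ ⟧
⟦⟧-step (yes a) (yes c) (yes c′) f eq = contradiction c′ (proj₂ (to eq a))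
⟦⟧-step (yes a) (yes c) (no ¬c′) f eq = refl
⟦⟧-step (yes a) (no ¬c) c′       f eq = contradiction (proj₁ (to eq a)) ¬c
⟦⟧-step (no ¬a) (yes c) (yes c′) f eq = refl
⟦⟧-step (no ¬a) (yes c) (no ¬c′) f eq = contradiction (from eq (c , ¬c′)) ¬a
⟦⟧-step (no ¬a) (no ¬c) (yes c′) f eq = contradiction (f c′) ¬c
⟦⟧-step (no ¬a) (no ¬c) (no ¬c′) f eq = refl

⟦⟧-× : (d : Dec A) (e : Dec B) → ⟦ d ×-dec e ⟧ ≡ ⟦ d ⟧ * ⟦ e ⟧
⟦⟧-× (yes _) (yes _) = refl
⟦⟧-× (yes _) (no _)  = refl
⟦⟧-× (no _)  _       = refl

-- Serves the two elements where maximal chains meet: the peak when adding and the valley when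
-- removing. Each chain contributes one factor.
⟦⟧-step² : (d : Dec A) (c : Dec C) (c′ : Dec C′) (e : Dec D) (e′ : Dec D′) →
           (C′ → C) → (D′ → D) → A ⇔ ((C × ¬ C′) × (D × ¬ D′)) →
           ⟦ d ⟧ ≡ (⟦ c ⟧ - ⟦ c′ ⟧) * (⟦ e ⟧ - ⟦ e′ ⟧)
⟦⟧-step² d c c′ e e′ f g eq = begin
  ⟦ d ⟧                                        ≡⟨ ⟦⟧-⇔ d (s ×-dec t) eq ⟩
  ⟦ s ×-dec t ⟧                                ≡⟨ ⟦⟧-× s t ⟩
  ⟦ s ⟧ * ⟦ t ⟧                                ≡⟨ cong₂ _*_ (⟦⟧-step s c c′ f ⇔-refl) (⟦⟧-step t e e′ g ⇔-refl) ⟩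
  (⟦ c ⟧ - ⟦ c′ ⟧) * (⟦ e ⟧ - ⟦ e′ ⟧)          ∎
  where
  open ≡-Reasoning
  ⇔-refl : ∀ {X : Set} → X ⇔ X
  ⇔-refl = mk⇔ (λ z → z) (λ z → z)
  s = c ×-dec ¬? c′
  t = e ×-dec ¬? e′

-- The head is kept apart so that no trailing factor 1 arises: one, two or three indices compute
-- directly to `u i`, `u i * u j` or `u i * (u j * u k)`.
∏⁺ : (ℕ → ℤ) → ℕ → List ℕ → ℤ
∏⁺ u i []       = u i
∏⁺ u i (j ∷ js) = u i * ∏⁺ u j js

⟦All⟧ : {P : ℕ → Set} (P? : ∀ i → Dec (P i)) → ∀ i is →
        ⟦ All.all? P? (i ∷ is) ⟧ ≡ ∏⁺ (λ j → ⟦ P? j ⟧) i is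
⟦All⟧ P? i []       with P? i
... | yes _ = refl
... | no _  = refl
⟦All⟧ P? i (j ∷ js) =
  trans (⟦⟧-× (P? i) (All.all? P? (j ∷ js))) (cong (⟦ P? i ⟧ *_) (⟦All⟧ P? j js))

∈-tabulate⇔ : ∀ {n} {P : Fin n → Set} (P? : ∀ p → Dec (P p)) {p} →
              p ∈ tabulate (λ q → does (P? q)) ⇔ P p
∈-tabulate⇔ P? {p} = mk⇔
  (λ p∈ → does⇒ (P? p) (trans (sym (lookup∘tabulate (λ q → does (P? q)) p)) ([]=⇒lookup p∈)))
  (λ Pp → lookup⇒[]= p _ (trans (lookup∘tabulate (λ q → does (P? q)) p) (dec-true (P? p) Pp)))
  where
  does⇒ : (d : Dec A) → does d ≡ true → A
  does⇒ (yes a) _ = a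

-- Telescoping sums and the closing polynomial identity.

Δ : (ℕ → ℤ) → ℕ → ℤ
Δ F k = F k - F (suc k)

telescope : ∀ n (t F : ℕ → ℤ) → (∀ k → k < n → t k ≡ Δ F k) → sum {n} (λ k → t (toℕ k)) ≡ F 0 - F n
telescope zero    t F eq = sym (ℤ.+-inverseʳ (F 0))
telescope (suc n) t F eq = trans
  (cong₂ _+_ (eq 0 (s≤s z≤n)) (telescope n (t ∘ suc) (F ∘ suc) (λ k k<n → eq (suc k) (s≤s k<n))))
  (ring (F 0) (F 1) (F (suc n)))
  where
  ring : ∀ x y z → (x - y) + (y - z) ≡ x - z
  ring = solve-∀

sum-last : ∀ n (t : ℕ → ℤ) → sum {suc n} (λ k → t (toℕ k)) ≡ sum {n} (λ k → t (toℕ k)) + t n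
sum-last zero    t = ℤ.+-comm (t 0) 0ℤ
sum-last (suc n) t = trans (cong (λ s → t 0 + s) (sum-last n (t ∘ suc))) (sym (ℤ.+-assoc (t 0) _ (t (suc n))))

-- The left side lists the boundary terms of the six evaluated sums for a = 1 + N, with `f 0` and
-- `g 0` already 1 and the factors 0 left in place so that they match by computation. After
-- substituting the first three equations, the excess over `dₐ - d₂ₐ` consists of multiples of the
-- two products assumed to vanish.
combine : ∀ N f₁ fₙ fₐ g₁ g₂ gₐ g₊ uₐ dₐ u₂ₐ d₂ₐ →
  fₐ ≡ dₐ → g₊ ≡ 0ℤ → u₂ₐ ≡ 1ℤ - g₁ → dₐ * d₂ₐ ≡ 0ℤ → uₐ * u₂ₐ ≡ 0ℤ →
  ((- (0ℤ * (1ℤ - f₁)) - 1ℤ) - (- (N * (fₙ - fₐ)) - fₙ)) + - (1ℤ + N) * (uₐ - dₐ)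
  - N * (u₂ₐ - d₂ₐ)
  + ((0ℤ * (gₐ - g₊) - g₊) - (N * (g₁ - g₂) - g₂))
  + ((1ℤ + N) * ((1ℤ - f₁) * (1ℤ - g₂) + (1ℤ - g₂ - d₂ₐ) * f₁)
     - (1ℤ + N) * ((fₙ - fₐ) * (1ℤ - g₊) + (1ℤ - g₂ - d₂ₐ) * fₐ))
  + ((1ℤ + N) * (uₐ * g₁ - dₐ * g₂) - (1ℤ + N) * (uₐ * gₐ - dₐ * g₊))
  + (- (1ℤ + N) * ((1ℤ - f₁) * d₂ₐ) - - (1ℤ + N) * (uₐ * (gₐ - g₊)))
  ≡ dₐ - d₂ₐ
combine N f₁ fₙ dₐ g₁ g₂ gₐ _ uₐ _ _ d₂ₐ refl refl refl dd≡0 uu≡0 = begin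
  _ ≡⟨ expand N f₁ fₙ g₁ g₂ gₐ uₐ dₐ d₂ₐ ⟩
  dₐ - d₂ₐ + (1ℤ + N) * (dₐ * d₂ₐ) - (1ℤ + N) * (uₐ * (1ℤ - g₁))
    ≡⟨ cong₂ (λ v w → dₐ - d₂ₐ + (1ℤ + N) * v - (1ℤ + N) * w) dd≡0 uu≡0 ⟩
  dₐ - d₂ₐ + (1ℤ + N) * 0ℤ - (1ℤ + N) * 0ℤ
    ≡⟨ cancel dₐ d₂ₐ (1ℤ + N) ⟩
  dₐ - d₂ₐ ∎
  where
  open ≡-Reasoning
  expand : ∀ N f₁ fₙ g₁ g₂ gₐ uₐ dₐ d₂ₐ →
    ((- (0ℤ * (1ℤ - f₁)) - 1ℤ) - (- (N * (fₙ - dₐ)) - fₙ)) + - (1ℤ + N) * (uₐ - dₐ)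
    - N * ((1ℤ - g₁) - d₂ₐ)
    + ((0ℤ * (gₐ - 0ℤ) - 0ℤ) - (N * (g₁ - g₂) - g₂))
    + ((1ℤ + N) * ((1ℤ - f₁) * (1ℤ - g₂) + (1ℤ - g₂ - d₂ₐ) * f₁)
       - (1ℤ + N) * ((fₙ - dₐ) * (1ℤ - 0ℤ) + (1ℤ - g₂ - d₂ₐ) * dₐ))
    + ((1ℤ + N) * (uₐ * g₁ - dₐ * g₂) - (1ℤ + N) * (uₐ * gₐ - dₐ * 0ℤ))
    + (- (1ℤ + N) * ((1ℤ - f₁) * d₂ₐ) - - (1ℤ + N) * (uₐ * (gₐ - 0ℤ)))
    ≡ dₐ - d₂ₐ + (1ℤ + N) * (dₐ * d₂ₐ) - (1ℤ + N) * (uₐ * (1ℤ - g₁))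
  expand = solve-∀
  cancel : ∀ x y z → x - y + z * 0ℤ - z * 0ℤ ≡ x - y
  cancel = solve-∀

-- Addable and removable elements, indexed by natural-number labels.

module Boundary (a : ℕ) (2≤a : 2 ≤ a) (I : Fence.𝒥 a) where

  open Fence a

  1≤a : 1 ≤ a
  1≤a = ≤-trans (s≤s z≤n) 2≤a

  a<2a : a < 2 ℕ.* a
  a<2a = m<m+n a (≤-trans 1≤a (m≤m+n a 0))

  a≤2a : a ≤ 2 ℕ.* a
  a≤2a = <⇒≤ a<2a

  <3a⇒inRange : ∀ {i} → 1 ≤ i → i < 3 ℕ.* a → InRange i
  <3a⇒inRange 1≤i i<3a = 1≤i , ∸-monoˡ-≤ 1 i<3a

  -- Membership becomes a predicate on all natural numbers, false outside the range of labels, so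
  -- neighbouring indices can be named without range proofs.
  Labelled : Subset (3 ℕ.* a ∸ 1) → ℕ → Set
  Labelled S i = ∃ λ p → label p ≡ i × p ∈ S

  labelled? : ∀ S i → Dec (Labelled S i)
  labelled? S i = any? (λ p → (label p ℕ.≟ i) ×-dec (p ∈? S))

  label-injective : {p q : Fin (3 ℕ.* a ∸ 1)} → label p ≡ label q → p ≡ q
  label-injective eq = toℕ-injective (suc-injective eq)

  label-inRange : ∀ p → InRange (label p)
  label-inRange p = s≤s z≤n , toℕ<n p

  In Addable Removable : ℕ → Set
  In        = Labelled (ideal I)
  Addable   = Labelled (min (∁ (ideal I)))
  Removable = Labelled (max (ideal I))

  in? : ∀ i → Dec (In i)
  in? = labelled? (ideal I)

  addable? : ∀ i → Dec (Addable i)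
  addable? = labelled? (min (∁ (ideal I)))

  removable? : ∀ i → Dec (Removable i)
  removable? = labelled? (max (ideal I))

  Cover Below : ℕ → ℕ → Set
  Cover i j = (j ≡ suc i × j ≤ a) ⊎ (i ≡ suc j × a ≤ j × i ≤ 2 ℕ.* a) ⊎ (j ≡ suc i × 2 ℕ.* a ≤ i)
  Below i j = (i ≤ j × j ≤ a) ⊎ (a ≤ j × j ≤ i × i ≤ 2 ℕ.* a) ⊎ (2 ℕ.* a ≤ i × i ≤ j)

  cover⇒⋖ : {p q : Fin (3 ℕ.* a ∸ 1)} → Cover (label p) (label q) → a ⊢ p ⋖ q
  cover⇒⋖ (inj₁ (e , u))            = rise₁ e u
  cover⇒⋖ (inj₂ (inj₁ (e , u , v))) = fall e u v
  cover⇒⋖ (inj₂ (inj₂ (e , u)))     = rise₂ e u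

  ⋖⇒cover : {p q : Fin (3 ℕ.* a ∸ 1)} → a ⊢ p ⋖ q → Cover (label p) (label q)
  ⋖⇒cover (rise₁ e u)  = inj₁ (e , u)
  ⋖⇒cover (fall e u v) = inj₂ (inj₁ (e , u , v))
  ⋖⇒cover (rise₂ e u)  = inj₂ (inj₂ (e , u))

  in-label : ∀ {p} → In (label p) → p ∈ ideal I
  in-label (q , e , q∈I) = subst (_∈ ideal I) (label-injective e) q∈I

  in-below : ∀ {i j} → InRange i → Below i j → In j → In i
  in-below {i} r b (q , refl , q∈I) =
    x i r , label-x i r , closed I (⊑⇒≼ (subst (λ k → Below k (label q)) (sym (label-x i r)) b)) q∈I

  -- Upper covers suffice: if p is covered by s and s lies below some q in the ideal, then s is in
  -- the ideal too.
  removable⇔ : ∀ {i} → Removable i ⇔ (In i × (∀ {j} → Cover i j → ¬ In j))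
  removable⇔ = mk⇔ f g
    where
    f : ∀ {i} → Removable i → In i × (∀ {j} → Cover i j → ¬ In j)
    f (p , refl , p∈max) with to (∈-tabulate⇔ (isMaximal? (ideal I))) p∈max
    ... | p∈I , maximal = (p , refl , p∈I) , above
      where
      above : ∀ {j} → Cover (label p) j → ¬ In j
      above c (q , refl , q∈I) with maximal q q∈I (cover⇒⋖ c ◅ ε)
      above (inj₁ (e , _))            (q , refl , q∈I) | refl = contradiction (sym e) 1+n≢n
      above (inj₂ (inj₁ (e , _ , _))) (q , refl , q∈I) | refl = contradiction (sym e) 1+n≢n
      above (inj₂ (inj₂ (e , _)))     (q , refl , q∈I) | refl = contradiction (sym e) 1+n≢n
    g : ∀ {i} → In i × (∀ {j} → Cover i j → ¬ In j) → Removable i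
    g ((p , refl , p∈I) , above) = p , refl , from (∈-tabulate⇔ (isMaximal? (ideal I))) (p∈I , maximal)
      where
      maximal : ∀ q → q ∈ ideal I → a ⊢ p ≼ q → q ≡ p
      maximal q q∈I ε        = refl
      maximal q q∈I (c ◅ cs) = contradiction (_ , refl , closed I cs q∈I) (above (⋖⇒cover c))

  -- Dually, lower covers suffice. The range condition on `j` matters because `Cover 0 1` holds
  -- although 0 labels no element.
  addable⇔ : ∀ {i} → InRange i → Addable i ⇔ (¬ In i × (∀ {j} → InRange j → Cover j i → In j))
  addable⇔ {i} r = mk⇔ f g
    where
    f : ∀ {i} → Addable i → ¬ In i × (∀ {j} → InRange j → Cover j i → In j)
    f (p , refl , p∈min) with to (∈-tabulate⇔ (isMinimal? (∁ (ideal I)))) p∈min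
    ... | p∈∁I , minimal = x∈∁p⇒x∉p p∈∁I ∘ in-label , below
      where
      irreflexive : ∀ {i} → ¬ Cover i i
      irreflexive (inj₁ (e , _))            = 1+n≢n (sym e)
      irreflexive (inj₂ (inj₁ (e , _ , _))) = 1+n≢n (sym e)
      irreflexive (inj₂ (inj₂ (e , _)))     = 1+n≢n (sym e)
      below : ∀ {j} → InRange j → Cover j (label p) → In j
      below {j} s c with in? j
      ... | yes j∈I = j∈I
      ... | no  j∉I with minimal (x j s) (x∉p⇒x∈∁p (λ m → j∉I (x j s , label-x j s , m)))
                           (cover⇒⋖ (subst (λ k → Cover k (label p)) (sym (label-x j s)) c) ◅ ε)
      ... | e = contradiction (subst (λ k → Cover k (label p)) (trans (sym (label-x j s)) (cong label e)) c) irreflexive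
    g : ¬ In i × (∀ {j} → InRange j → Cover j i → In j) → Addable i
    g (i∉I , below) = p , label-x i r ,
      from (∈-tabulate⇔ (isMinimal? (∁ (ideal I)))) (x∉p⇒x∈∁p (λ m → i∉I (p , label-x i r , m)) , minimal)
      where
      p = x i r
      minimal : ∀ q → q ∈ ∁ (ideal I) → a ⊢ q ≼ p → q ≡ p
      minimal q q∈∁I ε = refl
      minimal q q∈∁I (_◅_ {j = s} c cs) with s ∈? ideal I
      ... | yes s∈I = contradiction (closed I (c ◅ ε) s∈I) (x∈∁p⇒x∉p q∈∁I)
      -- By induction along the chain `s` equals `p`, so `q` is a lower cover of `p` and must lie in
      -- the ideal.
      ... | no  s∉I with minimal s (x∉p⇒x∈∁p s∉I) cs
      ... | refl = contradiction
        (in-label (below (label-inRange q) (subst (Cover (label q)) (label-x i r) (⋖⇒cover c))))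
        (x∈∁p⇒x∉p q∈∁I)

  -- Toggleability as a difference of products of indicators.

  u d : ℕ → ℤ
  u i = ⟦ addable? i ⟧
  d i = ⟦ removable? i ⟧

  χ≡d : ∀ i (r : InRange i) → χ (x i r) I ≡ d i
  χ≡d i r = ⟦⟧-⇔ (x i r ∈? max (ideal I)) (removable? i) (mk⇔
    (λ m → x i r , label-x i r , m)
    (λ (p , e , m) → subst (_∈ max (ideal I)) (label-injective (trans e (sym (label-x i r)))) m))

  -- An index out of range would add nothing to `x[ is ]` yet falsify `Labelled S`, hence the range
  -- condition.
  x[]⊆⇔ : ∀ {is S} → All InRange is → x[ is ] ⊆ S ⇔ All (Labelled S) is
  x[]⊆⇔ {is} {S} rs = mk⇔
    (λ ⊆S → All.tabulate (λ {i} i∈ → let r = All.lookup rs i∈ in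
      x i r , label-x i r , ⊆S (from (∈-tabulate⇔ (λ p → label p ∈ˡ? is)) (subst (_∈ˡ is) (sym (label-x i r)) i∈))))
    (λ all {p} p∈ → let (q , e , q∈S) = All.lookup all (to (∈-tabulate⇔ (λ p → label p ∈ˡ? is)) p∈) in
      subst (_∈ S) (label-injective e) q∈S)

  -- The nested conditional becomes a difference because its two conditions exclude each other: the
  -- head element would be both outside and inside the ideal.
  T≡ : ∀ i is → All InRange (i ∷ is) → T (i ∷ is) I ≡ ∏⁺ u i is - ∏⁺ d i is
  T≡ i is rs = trans (lemma (x[ i ∷ is ] ⊆? min (∁ (ideal I))) (x[ i ∷ is ] ⊆? max (ideal I))
      (All.all? addable? (i ∷ is)) (All.all? removable? (i ∷ is)) (x[]⊆⇔ rs) (x[]⊆⇔ rs) disjoint)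
    (cong₂ _-_ (⟦All⟧ addable? i is) (⟦All⟧ removable? i is))
    where
    lemma : (b : Dec A) (c : Dec B) (b′ : Dec C) (c′ : Dec D) → A ⇔ C → B ⇔ D → ¬ (C × D) →
            (if does b then 1ℤ else if does c then -1ℤ else 0ℤ) ≡ ⟦ b′ ⟧ - ⟦ c′ ⟧
    lemma b c b′ c′ eq eq′ ¬both
      rewrite does-⇔ eq b b′ | does-⇔ eq′ c c′ with b′ | c′
    ... | yes y | yes z = contradiction (y , z) ¬both
    ... | yes _ | no _  = refl
    ... | no _  | yes _ = refl
    ... | no _  | no _  = refl
    disjoint : ¬ (All Addable (i ∷ is) × All Removable (i ∷ is))
    disjoint (add ∷ _ , rem ∷ _) = proj₁ (to (addable⇔ (All.head rs)) add) (proj₁ (to removable⇔ rem))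

  -- The three maximal chains, each extended by a formal bottom element 0 that
  -- lies in every ideal: Left i is xᵢ, Right (1 + j) is x_{2a+j}, and
  -- Middle (1 + k) is x_{2a-k}.  The cutoff at a makes f (suc a) vanish.
  Left Right Middle : ℕ → Set
  Left zero      = ⊤
  Left (suc i)   = suc i ≤ a × In (suc i)
  Right zero     = ⊤
  Right (suc j)  = In (2 ℕ.* a ℕ.+ j)
  Middle zero    = ⊤
  Middle (suc k) = In (2 ℕ.* a ∸ k)

  left? : ∀ i → Dec (Left i)
  left? zero    = yes tt
  left? (suc i) = (suc i ≤? a) ×-dec in? (suc i)

  right? : ∀ j → Dec (Right j)
  right? zero    = yes tt
  right? (suc j) = in? (2 ℕ.* a ℕ.+ j)

  middle? : ∀ k → Dec (Middle k)
  middle? zero    = yes tt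
  middle? (suc k) = in? (2 ℕ.* a ∸ k)

  f g m : ℕ → ℤ
  f i = ⟦ left? i ⟧
  g j = ⟦ right? j ⟧
  m k = ⟦ middle? k ⟧

  -- Index bounds and initial segments of the three chains.

  inRange-left : ∀ {i} → 1 ≤ i → i ≤ a → InRange i
  inRange-left 1≤i i≤a = <3a⇒inRange 1≤i (≤-<-trans i≤a (<-≤-trans a<2a (m≤n+m (2 ℕ.* a) a)))

  inRange-middle : ∀ {i} → 1 ≤ i → i ≤ 2 ℕ.* a → InRange i
  inRange-middle 1≤i i≤2a = <3a⇒inRange 1≤i (≤-<-trans i≤2a (m<n+m (2 ℕ.* a) 1≤a))

  inRange-right : ∀ {j} → j < a → InRange (2 ℕ.* a ℕ.+ j)
  inRange-right {j} j<a = <3a⇒inRange (≤-trans (≤-trans 1≤a a≤2a) (m≤m+n _ j))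
    (subst (2 ℕ.* a ℕ.+ j <_) (+-comm (2 ℕ.* a) a) (+-monoʳ-< (2 ℕ.* a) j<a))

  -- The index is 2a + a = 3a, one past the last label.
  ¬right-end : ¬ Right (suc a)
  ¬right-end (p , e , _) = <⇒≱ (≤-<-trans (proj₂ (label-inRange p)) (∸-monoʳ-< z<s (≤-trans 1≤a (m≤m+n a _))))
    (≤-reflexive (trans (+-comm a (2 ℕ.* a)) (sym e)))

  ¬left-end : ¬ Left (suc a)
  ¬left-end (1+a≤a , _) = 1+n≰n 1+a≤a

  suc-∸ : ∀ {k} → k < a → suc (2 ℕ.* a ∸ suc k) ≡ 2 ℕ.* a ∸ k
  suc-∸ {k} k<a = sym (+-∸-assoc 1 (≤-trans k<a a≤2a))

  a≤2a∸ : ∀ {k} → k ≤ a → a ≤ 2 ℕ.* a ∸ k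
  a≤2a∸ {k} k≤a = ≤-trans (≤-reflexive (trans (sym (+-identityʳ a)) (sym (m+n∸m≡n a (a ℕ.+ 0))))) (∸-monoʳ-≤ (2 ℕ.* a) k≤a)

  left-↓ : ∀ k → Left (suc k) → Left k
  left-↓ zero    _          = tt
  left-↓ (suc k) (le , k∈I) = k≤a , in-below (inRange-left (s≤s z≤n) k≤a) (inj₁ (n≤1+n (suc k) , le)) k∈I
    where k≤a = ≤-trans (n≤1+n (suc k)) le

  right-↓ : ∀ k → k < suc a → Right (suc k) → Right k
  right-↓ zero    _       _   = tt
  right-↓ (suc k) (s≤s k<a) k∈I = in-below (inRange-right k<a)
    (inj₂ (inj₂ (m≤m+n _ k , +-monoʳ-≤ (2 ℕ.* a) (n≤1+n k)))) k∈I

  -- The bound keeps the index 2a - k + 1 above a, so that both elements stay on the descending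
  -- stretch of the fence.
  middle-↓ : ∀ k → k ≤ a → Middle (suc k) → Middle k
  middle-↓ zero    _   _   = tt
  middle-↓ (suc k) k≤a k∈I = in-below
    (inRange-middle (≤-trans 1≤a (a≤2a∸ (<⇒≤ k≤a))) (m∸n≤m (2 ℕ.* a) k))
    (inj₂ (inj₁ (a≤2a∸ k≤a , ∸-monoʳ-≤ (2 ℕ.* a) (n≤1+n k) , m∸n≤m (2 ℕ.* a) k))) k∈I

  -- Addability and removability read off the chains.

  removable-left : ∀ k → k < a → Removable (suc k) ⇔ (Left (suc k) × ¬ Left (2 ℕ.+ k))
  removable-left k k<a = mk⇔
    (λ r → let (i , n) = to removable⇔ r in
      (k<a , i) , λ (le , j) → n (inj₁ (refl , le)) j)
    (λ ((_ , i) , n) → from removable⇔ (i , λ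
      -- At the peak, `suc k ≡ a`, this case is void and `Left (2 ℕ.+ k)` fails through its cutoff,
      -- so the peak is covered as well.
      { (inj₁ (refl , le))           j∈I → n (le , j∈I)
      ; (inj₂ (inj₁ (refl , le , _))) _  → contradiction le (<⇒≱ k<a)
      ; (inj₂ (inj₂ (_ , le)))        _  → contradiction le (<⇒≱ (≤-<-trans k<a a<2a)) }))

  removable-right : ∀ j → Removable (2 ℕ.* a ℕ.+ suc j) ⇔ (Right (2 ℕ.+ j) × ¬ Right (3 ℕ.+ j))
  removable-right j = mk⇔
    (λ r → let (i , n) = to removable⇔ r in
      i , n (inj₂ (inj₂ (+-suc _ (suc j) , m≤m+n _ (suc j)))))
    (λ (i , n) → from removable⇔ (i , λ
      { (inj₁ (refl , le)) _ → contradiction le (<⇒≱ (<-≤-trans a<2a (≤-trans (m≤m+n _ (suc j)) (n≤1+n _))))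
      ; (inj₂ (inj₁ (_ , _ , le))) _ → contradiction le (<⇒≱ (m<m+n _ z<s))
      ; (inj₂ (inj₂ (refl , _))) j∈I → n (subst In (sym (+-suc _ (suc j))) j∈I) }))

  -- The valley has an upper cover on each of two chains. Its own membership is recorded twice, as
  -- `Right 1` and `Middle 1`, so that each factor is a drop along one chain.
  removable-valley : Removable (2 ℕ.* a) ⇔ ((Right 1 × ¬ Right 2) × (Middle 1 × ¬ Middle 2))
  removable-valley = mk⇔
    (λ r → let (i , n) = to removable⇔ r in
      (subst In (sym (+-identityʳ _)) i , n (inj₂ (inj₂ (+-comm _ 1 , ≤-refl)))) ,
      (i , n (inj₂ (inj₁ (sym (suc-∸ 1≤a) , a≤2a∸ 1≤a , ≤-refl)))))
    (λ ((_ , n) , (i , n′)) → from removable⇔ (i , λ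
      { (inj₁ (refl , le)) _ → contradiction le (<⇒≱ (≤-trans a<2a (n≤1+n _)))
      ; (inj₂ (inj₁ (e , _ , _))) j∈I → n′ (subst In (suc-injective (trans (sym e) (sym (suc-∸ 1≤a)))) j∈I)
      ; (inj₂ (inj₂ (refl , _))) j∈I → n (subst In (sym (+-comm _ 1)) j∈I) }))

  removable-middle : ∀ k → suc k < a → Removable (2 ℕ.* a ∸ suc k) ⇔ (Middle (2 ℕ.+ k) × ¬ Middle (3 ℕ.+ k))
  removable-middle k k<a = mk⇔
    (λ r → let (i , n) = to removable⇔ r in
      i , n (inj₂ (inj₁ (sym (suc-∸ k<a) , a≤2a∸ k<a , m∸n≤m (2 ℕ.* a) (suc k)))))
    (λ (i , n) → from removable⇔ (i , λ
      { (inj₁ (refl , le)) _ → contradiction le (<⇒≱ (s≤s (a≤2a∸ (<⇒≤ k<a))))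
      ; (inj₂ (inj₁ (e , _ , _))) j∈I → n (subst In (suc-injective (trans (sym e) (sym (suc-∸ k<a)))) j∈I)
      ; (inj₂ (inj₂ (_ , le))) _ → contradiction le (<⇒≱ (∸-monoʳ-< z<s (≤-trans (<⇒≤ k<a) a≤2a))) }))

  in-left : ∀ {k} → 1 ≤ k → Left k → In k
  in-left {suc k} _ (_ , i) = i

  left-lower : ∀ k → k < a → (∀ {j} → InRange j → Cover j (suc k) → In j) → Left k
  left-lower zero    _   _ = tt
  left-lower (suc k) k<a h = <⇒≤ k<a , h (inRange-left (s≤s z≤n) (<⇒≤ k<a)) (inj₁ (refl , k<a))

  addable-left : ∀ k → suc k < a → Addable (suc k) ⇔ (Left k × ¬ Left (suc k))
  addable-left k k<a = mk⇔
    (λ r → let (n , h) = to (addable⇔ range) r in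
      left-lower k (<⇒≤ k<a) h , λ (_ , i) → n i)
    (λ (i , n) → from (addable⇔ range) ((λ j → n (<⇒≤ k<a , j)) , λ
      { s (inj₁ (refl , _)) → in-left (proj₁ s) i
      ; _ (inj₂ (inj₁ (refl , le , _))) → contradiction le (<⇒≱ k<a)
      ; _ (inj₂ (inj₂ (refl , le))) → contradiction le (<⇒≱ (≤-<-trans (<⇒≤ (<⇒≤ k<a)) a<2a)) }))
    where range = inRange-left (s≤s z≤n) (<⇒≤ k<a)

  -- The peak has two lower covers, with labels a - 1 (the formal bottom if k = 0) and a + 1. Both
  -- `Left (suc k)` and `Middle (2 ℕ.+ k)` express membership of the peak itself.
  addable-peak : ∀ k → suc k ≡ a → Addable (suc k) ⇔ ((Left k × ¬ Left (suc k)) × (Middle (suc k) × ¬ Middle (2 ℕ.+ k)))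
  addable-peak k 1+k≡a = mk⇔
    (λ r → let (n , h) = to (addable⇔ range) r in
      (left-lower k k<a h , λ (_ , i) → n i) ,
      (h (inRange-middle (≤-trans 1≤a (a≤2a∸ (<⇒≤ k<a))) (m∸n≤m (2 ℕ.* a) k))
         (inj₂ (inj₁ (trans (sym (suc-∸ k<a)) (cong suc 2a∸a) , ≤-reflexive (sym 1+k≡a) , m∸n≤m (2 ℕ.* a) k))) ,
       n ∘ subst In 2a∸a))
    (λ ((i , n) , (i′ , _)) → from (addable⇔ range) ((λ j → n (k<a , j)) , λ
      { s (inj₁ (refl , _)) → in-left (proj₁ s) i
      ; _ (inj₂ (inj₁ (refl , _ , _))) → subst In (trans (sym (suc-∸ k<a)) (cong suc 2a∸a)) i′
      ; _ (inj₂ (inj₂ (refl , le))) → contradiction le (<⇒≱ (≤-<-trans (<⇒≤ k<a) a<2a)) }))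
    where
    k<a = ≤-reflexive 1+k≡a
    range = inRange-left (s≤s z≤n) k<a
    2a∸a : 2 ℕ.* a ∸ suc k ≡ suc k
    2a∸a = trans (cong (2 ℕ.* a ∸_) 1+k≡a) (trans (m+n∸m≡n a (a ℕ.+ 0)) (trans (+-identityʳ a) (sym 1+k≡a)))

  addable-middle : ∀ k → suc k < a → Addable (2 ℕ.* a ∸ suc k) ⇔ (Middle (suc k) × ¬ Middle (2 ℕ.+ k))
  addable-middle k k<a = mk⇔
    (λ r → let (n , h) = to (addable⇔ range) r in
      h (inRange-middle (≤-trans 1≤a (a≤2a∸ (<⇒≤ (<⇒≤ k<a)))) (m∸n≤m (2 ℕ.* a) k))
        (inj₂ (inj₁ (sym (suc-∸ (<⇒≤ k<a)) , a≤2a∸ (<⇒≤ k<a) , m∸n≤m (2 ℕ.* a) k))) , n)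
    (λ (i , n) → from (addable⇔ range) (n , λ
      { _ (inj₁ (_ , le)) → contradiction le (<⇒≱ (a<2a∸ k<a))
      ; _ (inj₂ (inj₁ (refl , _ , _))) → subst In (sym (suc-∸ (<⇒≤ k<a))) i
      ; _ (inj₂ (inj₂ (e , le))) → contradiction le (<⇒≱ (≤-trans (≤-reflexive (sym e)) (m∸n≤m (2 ℕ.* a) (suc k)))) }))
    where
    range = inRange-middle (≤-trans 1≤a (a≤2a∸ (<⇒≤ k<a))) (m∸n≤m (2 ℕ.* a) (suc k))
    a<2a∸ : ∀ {j} → j < a → a < 2 ℕ.* a ∸ j
    a<2a∸ j<a = ≤-trans (s≤s (a≤2a∸ j<a)) (≤-reflexive (suc-∸ j<a))

  -- The valley is the case j = 0: it is minimal in the fence, which matches the formal bottom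
  -- `Right 0`.
  addable-right : ∀ j → j < a → Addable (2 ℕ.* a ℕ.+ j) ⇔ (Right j × ¬ Right (suc j))
  addable-right j j<a = mk⇔
    (λ r → let (n , h) = to (addable⇔ (inRange-right j<a)) r in lower j j<a h , n)
    (λ (i , n) → from (addable⇔ (inRange-right j<a)) (n , λ
      { _ (inj₁ (_ , le)) → contradiction le (<⇒≱ (<-≤-trans a<2a (m≤m+n _ j)))
      ; _ (inj₂ (inj₁ (refl , _ , le))) → contradiction le (<⇒≱ (s≤s (m≤m+n _ j)))
      ; _ (inj₂ (inj₂ (e , le))) → upper j e le i }))
    where
    lower : ∀ j → j < a → (∀ {k} → InRange k → Cover k (2 ℕ.* a ℕ.+ j) → In k) → Right j
    lower zero    _   _ = tt
    lower (suc j) j<a h = h (inRange-right (<⇒≤ j<a)) (inj₂ (inj₂ (+-suc _ j , m≤m+n _ j)))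
    upper : ∀ j {k} → 2 ℕ.* a ℕ.+ j ≡ suc k → 2 ℕ.* a ≤ k → Right j → In k
    upper zero    e le _ = contradiction (≤-trans (≤-reflexive (sym e)) (≤-reflexive (+-identityʳ _))) (<⇒≱ (s≤s le))
    upper (suc j) e _  i = subst In (suc-injective (trans (sym (+-suc _ j)) e)) i

  -- Indicators as consecutive differences, and the two vanishing products.

  u-left : ∀ k → suc k < a → u (suc k) ≡ Δ f k
  u-left k k<a = ⟦⟧-step (addable? (suc k)) (left? k) (left? (suc k)) (left-↓ k) (addable-left k k<a)

  d-left : ∀ k → k < a → d (suc k) ≡ Δ f (suc k)
  d-left k k<a = ⟦⟧-step (removable? (suc k)) (left? (suc k)) (left? (2 ℕ.+ k)) (left-↓ (suc k)) (removable-left k k<a)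

  u-peak : ∀ k → suc k ≡ a → u (suc k) ≡ Δ f k * Δ m (suc k)
  u-peak k 1+k≡a = ⟦⟧-step² (addable? (suc k)) (left? k) (left? (suc k)) (middle? (suc k)) (middle? (2 ℕ.+ k))
    (left-↓ k) (middle-↓ (suc k) (≤-reflexive 1+k≡a)) (addable-peak k 1+k≡a)

  d-valley : d (2 ℕ.* a) ≡ Δ g 1 * Δ m 1
  d-valley = ⟦⟧-step² (removable? (2 ℕ.* a)) (right? 1) (right? 2) (middle? 1) (middle? 2)
    (right-↓ 1 (s≤s 1≤a)) (middle-↓ 1 1≤a) removable-valley

  u-right : ∀ j → j < a → u (2 ℕ.* a ℕ.+ j) ≡ Δ g j
  u-right j j<a = ⟦⟧-step (addable? (2 ℕ.* a ℕ.+ j)) (right? j) (right? (suc j))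
    (right-↓ j (≤-trans j<a (n≤1+n a))) (addable-right j j<a)

  d-right : ∀ j → suc j < a → d (2 ℕ.* a ℕ.+ suc j) ≡ Δ g (2 ℕ.+ j)
  d-right j j<a = ⟦⟧-step (removable? (2 ℕ.* a ℕ.+ suc j)) (right? (2 ℕ.+ j)) (right? (3 ℕ.+ j))
    (right-↓ (2 ℕ.+ j) (s≤s j<a)) (removable-right j)

  u-middle : ∀ k → suc k < a → u (2 ℕ.* a ∸ suc k) ≡ Δ m (suc k)
  u-middle k k<a = ⟦⟧-step (addable? (2 ℕ.* a ∸ suc k)) (middle? (suc k)) (middle? (2 ℕ.+ k))
    (middle-↓ (suc k) (<⇒≤ k<a)) (addable-middle k k<a)

  d-middle : ∀ k → suc k < a → d (2 ℕ.* a ∸ suc k) ≡ Δ m (2 ℕ.+ k)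
  d-middle k k<a = ⟦⟧-step (removable? (2 ℕ.* a ∸ suc k)) (middle? (2 ℕ.+ k)) (middle? (3 ℕ.+ k))
    (middle-↓ (2 ℕ.+ k) k<a) (removable-middle k k<a)

  -- If the peak is in the ideal, so is the element labelled 2a - 1, which covers the valley and
  -- blocks its removal.
  d-peak*d-valley : d a * d (2 ℕ.* a) ≡ 0ℤ
  d-peak*d-valley = trans (sym (⟦⟧-× (removable? a) (removable? (2 ℕ.* a))))
    (⟦⟧-false (removable? a ×-dec removable? (2 ℕ.* a)) λ (r , s) →
    proj₂ (proj₂ (to removable-valley s))
      (in-below (inRange-middle (≤-trans 1≤a (a≤2a∸ 1≤a)) (m∸n≤m (2 ℕ.* a) 1))
        (inj₂ (inj₁ (≤-refl , a≤2a∸ 1≤a , m∸n≤m (2 ℕ.* a) 1))) (proj₁ (to removable⇔ r))))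

  -- If the peak is addable, its lower cover labelled a + 1 is in the ideal, and with it the valley
  -- below.
  u-peak*u-valley : u a * u (2 ℕ.* a) ≡ 0ℤ
  u-peak*u-valley = trans (sym (⟦⟧-× (addable? a) (addable? (2 ℕ.* a))))
    (⟦⟧-false (addable? a ×-dec addable? (2 ℕ.* a)) λ (r , s) →
    proj₁ (to (addable⇔ range) s)
      (in-below range (inj₂ (inj₁ (n≤1+n a , a<2a , ≤-refl)))
        (proj₂ (to (addable⇔ (inRange-left 1≤a ≤-refl)) r) (inRange-middle (s≤s z≤n) a<2a)
          (inj₂ (inj₁ (refl , ≤-refl , a<2a))))))
    where range = inRange-middle (≤-trans 1≤a a≤2a) ≤-refl

  f-end : f (suc a) ≡ 0ℤ
  f-end = ⟦⟧-false (left? (suc a)) ¬left-end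

  g-end : g (suc a) ≡ 0ℤ
  g-end = ⟦⟧-false (right? (suc a)) ¬right-end

-- Evaluation of the six terms by telescoping, with a = N + 1.

module Sums (N : ℕ) (1≤N : 1 ≤ N) (I : Fence.𝒥 (suc N)) where

  private
    a : ℕ
    a = suc N
    α : ℤ
    α = + a

  open Fence (suc N)
  open Boundary (suc N) (s≤s 1≤N) I

  inRange-a : InRange a
  inRange-a = inRange-left (s≤s z≤n) ≤-refl

  inRange-2a : InRange (2 ℕ.* a)
  inRange-2a = inRange-middle (s≤s z≤n) ≤-refl

  inRange-2a+0 : InRange (2 ℕ.* a ℕ.+ 0)
  inRange-2a+0 = inRange-right (s≤s z≤n)

  -- Summation by parts: below the peak each term is a weighted second difference of `f`. The peak
  -- is split off because its addability also depends on the middle chain.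
  S₁ : (∑[ i ≔ 1 ⋯ a ] (- (+ i) * T (i ∷ []) I))
       ≡ ((- (+ 0 * Δ f 0) - f 0) - (- (+ N * Δ f N) - f N)) + - α * (u a - d a)
  S₁ = trans (sum-last N (λ k → - (+ suc k) * T (suc k ∷ []) I)) (cong₂ _+_
    (telescope N _ (λ k → - (+ k * Δ f k) - f k) term)
    (cong (- α *_) (T≡ a [] (inRange-a ∷ []))))
    where
    ring : ∀ K x y z → - (1ℤ + K) * ((x - y) - (y - z)) ≡ (- (K * (x - y)) - x) - (- ((1ℤ + K) * (y - z)) - y)
    ring = solve-∀
    term : ∀ k → k < N → - (+ suc k) * T (suc k ∷ []) I ≡ Δ (λ k → - (+ k * Δ f k) - f k) k
    term k k<N = trans
      (cong (- (+ suc k) *_) (trans (T≡ (suc k) [] (inRange-left (s≤s z≤n) (≤-trans k<N (n≤1+n N)) ∷ []))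
        (cong₂ _-_ (u-left k (s≤s k<N)) (d-left k (≤-trans k<N (n≤1+n N))))))
      (ring (+ k) (f k) (f (suc k)) (f (2 ℕ.+ k)))

  S₂ : T (2 ℕ.* a ∷ []) I ≡ u (2 ℕ.* a) - d (2 ℕ.* a)
  S₂ = T≡ (2 ℕ.* a) [] (inRange-2a ∷ [])

  -- Summation by parts again, along the right chain from its top downwards, which is why the
  -- potential is evaluated at `a ∸ k`.
  S₃ : (∑[ i ≔ 1 ⋯ a ∸ 1 ] (- (+ i) * T (3 ℕ.* a ∸ i ∷ []) I))
       ≡ (+ 0 * Δ g a - g (suc a)) - (+ N * Δ g 1 - g 2)
  S₃ = trans (telescope N _ F term) (cong (λ t → F 0 - (+ N * Δ g t - g (suc t))) (m+n∸n≡m 1 N))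
    where
    F : ℕ → ℤ
    F k = + k * Δ g (a ∸ k) - g (suc (a ∸ k))
    ring : ∀ K x y z → - (1ℤ + K) * ((x - y) - (y - z)) ≡ (K * (y - z) - z) - ((1ℤ + K) * (x - y) - y)
    ring = solve-∀
    term : ∀ k → k < N → - (+ suc k) * T (3 ℕ.* a ∸ suc k ∷ []) I ≡ Δ F k
    term k k<N = begin
      - (+ suc k) * T (3 ℕ.* a ∸ suc k ∷ []) I                  ≡⟨ cong (λ i → - (+ suc k) * T (i ∷ []) I) index ⟩
      - (+ suc k) * T (2 ℕ.* a ℕ.+ suc s ∷ []) I                ≡⟨ cong (- (+ suc k) *_) (T≡ _ [] (inRange-right s<N ∷ [])) ⟩
      - (+ suc k) * (u (2 ℕ.* a ℕ.+ suc s) - d (2 ℕ.* a ℕ.+ suc s))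
        ≡⟨ cong (- (+ suc k) *_) (cong₂ _-_ (u-right (suc s) s<N) (d-right s s<N)) ⟩
      - (+ suc k) * (Δ g (suc s) - Δ g (2 ℕ.+ s))               ≡⟨ ring (+ k) (g (suc s)) (g (2 ℕ.+ s)) (g (3 ℕ.+ s)) ⟩
      (+ k * Δ g (2 ℕ.+ s) - g (3 ℕ.+ s)) - (+ suc k * Δ g (suc s) - g (2 ℕ.+ s))
        ≡⟨ cong₂ (λ p q → (+ k * Δ g p - g (suc p)) - (+ suc k * Δ g q - g (suc q))) (sym 2+s≡) (sym 1+s≡) ⟩
      Δ F k                                                     ∎
      where
      open ≡-Reasoning
      s = N ∸ suc k
      1+s≡ : N ∸ k ≡ suc s
      1+s≡ = +-∸-assoc 1 k<N
      2+s≡ : a ∸ k ≡ 2 ℕ.+ s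
      2+s≡ = trans (+-∸-assoc 1 (<⇒≤ k<N)) (cong suc 1+s≡)
      s<N : suc s < a
      s<N = s≤s (≤-trans (≤-reflexive (sym 1+s≡)) (m∸n≤m N k))
      index : 3 ℕ.* a ∸ suc k ≡ 2 ℕ.* a ℕ.+ suc s
      index = trans (cong (_∸ suc k) (+-comm a (2 ℕ.* a)))
        (trans (+-∸-assoc (2 ℕ.* a) (≤-trans k<N (n≤1+n N))) (cong (2 ℕ.* a ℕ.+_) 1+s≡))

  Δ-linear : ∀ α x y p q r → α * (x * (p - q) - y * (q - r)) ≡ α * (x * p - y * q) - α * (x * q - y * r)
  Δ-linear = solve-∀

  -- The defect of the sum of d (2a + j) over 0 ≤ j ≤ i against g 0 - g (2 + i).
  κ : ℤ
  κ = g 0 - g 2 - d (2 ℕ.* a)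

  -- The inner sum telescopes in `g` except for `d (2 ℕ.* a)` at j = 0, which also involves the
  -- middle chain. The resulting error `κ * Δ f (suc k)` telescopes in turn, giving the summand
  -- `κ * f (suc k)` of the potential.
  S₄ : (∑[ i ≔ 1 ⋯ a ∸ 1 ] ∑[ j ≔ 0 ⋯ i ] (α * T (i ∷ 2 ℕ.* a ℕ.+ j ∷ []) I))
       ≡ α * (Δ f 0 * (g 0 - g 2) + κ * f 1) - α * (Δ f N * (g 0 - g (suc a)) + κ * f a)
  S₄ = telescope N _ F term
    where
    F : ℕ → ℤ
    F k = α * (Δ f k * (g 0 - g (2 ℕ.+ k)) + κ * f (suc k))
    ring : ∀ α x y z g0 g1 g2 p q v →
      α * ((x - y) * (g0 - g1) - (y - z) * v) + (α * ((x - y) * g1 - (y - z) * g2) - α * ((x - y) * p - (y - z) * q))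
      ≡ α * ((x - y) * (g0 - p) + (g0 - g2 - v) * y) - α * ((y - z) * (g0 - q) + (g0 - g2 - v) * z)
    ring = solve-∀
    term : ∀ k → k < N → sum {2 ℕ.+ k} (λ j → α * T (suc k ∷ 2 ℕ.* a ℕ.+ toℕ j ∷ []) I) ≡ Δ F k
    term k k<N = trans (cong₂ _+_ first (telescope (suc k) _ G rest))
      (ring α (f k) (f (suc k)) (f (2 ℕ.+ k)) (g 0) (g 1) (g 2) (g (2 ℕ.+ k)) (g (3 ℕ.+ k)) (d (2 ℕ.* a)))
      where
      k<a = ≤-trans k<N (n≤1+n N)
      range : InRange (suc k)
      range = inRange-left (s≤s z≤n) k<a
      G : ℕ → ℤ
      G j = α * (Δ f k * g (suc j) - Δ f (suc k) * g (2 ℕ.+ j))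
      first : α * T (suc k ∷ 2 ℕ.* a ℕ.+ 0 ∷ []) I ≡ α * (Δ f k * Δ g 0 - Δ f (suc k) * d (2 ℕ.* a))
      first = cong (α *_) (trans (T≡ (suc k) _ (range ∷ inRange-2a+0 ∷ []))
        (cong₂ _-_ (cong₂ _*_ (u-left k (s≤s k<N)) (u-right 0 (s≤s z≤n)))
                   (cong₂ _*_ (d-left k k<a) (cong d (+-identityʳ (2 ℕ.* a))))))
      rest : ∀ j → j < suc k → α * T (suc k ∷ 2 ℕ.* a ℕ.+ suc j ∷ []) I ≡ Δ G j
      rest j j≤k = trans (cong (α *_) (trans (T≡ (suc k) _ (range ∷ inRange-right j<N ∷ []))
        (cong₂ _-_ (cong₂ _*_ (u-left k (s≤s k<N)) (u-right (suc j) j<N))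
                   (cong₂ _*_ (d-left k k<a) (d-right j j<N)))))
        (Δ-linear α (Δ f k) (Δ f (suc k)) (g (suc j)) (g (2 ℕ.+ j)) (g (3 ℕ.+ j)))
        where
        j<N : suc j < a
        j<N = s≤s (≤-trans j≤k k<N)

  S₅ : (∑[ j ≔ 1 ⋯ a ∸ 1 ] (α * T (a ∷ 2 ℕ.* a ℕ.+ j ∷ []) I))
       ≡ α * (u a * g 1 - d a * g 2) - α * (u a * g a - d a * g (suc a))
  S₅ = telescope N _ F term
    where
    F : ℕ → ℤ
    F j = α * (u a * g (suc j) - d a * g (2 ℕ.+ j))
    term : ∀ j → j < N → α * T (a ∷ 2 ℕ.* a ℕ.+ suc j ∷ []) I ≡ Δ F j
    term j j<N = trans (cong (α *_) (trans (T≡ a _ (inRange-a ∷ inRange-right (s≤s j<N) ∷ []))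
      (cong₂ _-_ (cong (u a *_) (u-right (suc j) (s≤s j<N))) (cong (d a *_) (d-right j (s≤s j<N))))))
      (Δ-linear α (u a) (d a) (g (suc j)) (g (2 ℕ.+ j)) (g (3 ℕ.+ j)))

  -- Passing from addable to removable shifts all three factors by one index, so the triple product
  -- is its own potential.
  S₆ : (∑[ i ≔ 1 ⋯ a ∸ 1 ] (- α * T (i ∷ 2 ℕ.* a ∸ i ∷ 2 ℕ.* a ℕ.+ i ∷ []) I))
       ≡ - α * (Δ f 0 * d (2 ℕ.* a)) - - α * (u a * Δ g a)
  S₆ = trans (telescope N _ F term) (cong₂ _-_
    -- At the ends the middle factor pairs with the right one to give removability of the valley, or
    -- with the left one to give addability of the peak.
    (cong (λ v → - α * (Δ f 0 * v)) (trans (ℤ.*-comm (Δ m 1) (Δ g 1)) (sym d-valley)))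
    (cong (- α *_) (trans (sym (ℤ.*-assoc (Δ f N) (Δ m a) (Δ g a))) (cong (_* Δ g a) (sym (u-peak N refl))))))
    where
    F : ℕ → ℤ
    F k = - α * (Δ f k * (Δ m (suc k) * Δ g (suc k)))
    ring : ∀ B x y → B * (x - y) ≡ B * x - B * y
    ring = solve-∀
    term : ∀ k → k < N → - α * T (suc k ∷ 2 ℕ.* a ∸ suc k ∷ 2 ℕ.* a ℕ.+ suc k ∷ []) I ≡ Δ F k
    term k k<N = trans (cong (- α *_) (trans
      (T≡ (suc k) _ (inRange-left (s≤s z≤n) k<a
         ∷ inRange-middle (≤-trans (s≤s z≤n) (a≤2a∸ k<a)) (m∸n≤m (2 ℕ.* a) (suc k))
         ∷ inRange-right (s≤s k<N) ∷ []))
      (cong₂ _-_ (cong₂ _*_ (u-left k (s≤s k<N)) (cong₂ _*_ (u-middle k (s≤s k<N)) (u-right (suc k) (s≤s k<N))))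
                 (cong₂ _*_ (d-left k k<a) (cong₂ _*_ (d-middle k (s≤s k<N)) (d-right k (s≤s k<N)))))))
      (ring (- α) (Δ f k * (Δ m (suc k) * Δ g (suc k))) (Δ f (suc k) * (Δ m (2 ℕ.+ k) * Δ g (2 ℕ.+ k))))
      where k<a = ≤-trans k<N (n≤1+n N)

  u-valley : u (2 ℕ.* a) ≡ 1ℤ - g 1
  u-valley = trans (cong u (sym (+-identityʳ (2 ℕ.* a)))) (u-right 0 (s≤s z≤n))

  f-top : f a ≡ d a
  f-top = sym (trans (d-left N ≤-refl) (trans (cong (λ v → f a - v) f-end) (ℤ.+-identityʳ (f a))))

theorem5p8 : (a : ℕ) (2≤a : 2 ≤ a) → let open Fence a in (I : 𝒥) →
    χ (x a (a-inRange 2≤a)) I - χ (x (2 ℕ.* a) (2a-inRange 2≤a)) I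
    ≡ (∑[ i ≔ 1 ⋯ a ] (- (+ i) * T (i ∷ []) I))
    - + (a ∸ 1) * T (2 ℕ.* a ∷ []) I
    + (∑[ i ≔ 1 ⋯ a ∸ 1 ] (- (+ i) * T (3 ℕ.* a ∸ i ∷ []) I))
    + (∑[ i ≔ 1 ⋯ a ∸ 1 ] ∑[ j ≔ 0 ⋯ i ] (+ a * T (i ∷ 2 ℕ.* a ℕ.+ j ∷ []) I))
    + (∑[ j ≔ 1 ⋯ a ∸ 1 ] (+ a * T (a ∷ 2 ℕ.* a ℕ.+ j ∷ []) I))
    + (∑[ i ≔ 1 ⋯ a ∸ 1 ] (- (+ a) * T (i ∷ 2 ℕ.* a ∸ i ∷ 2 ℕ.* a ℕ.+ i ∷ []) I))
theorem5p8 (suc N) 2≤a@(s≤s 1≤N) I = begin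
  χ (x (suc N) (a-inRange 2≤a)) I - χ (x (2 ℕ.* suc N) (2a-inRange 2≤a)) I
    ≡⟨ cong₂ _-_ (χ≡d (suc N) (a-inRange 2≤a)) (χ≡d (2 ℕ.* suc N) (2a-inRange 2≤a)) ⟩
  d (suc N) - d (2 ℕ.* suc N)
    -- Used from right to left: the expanded side of `combine` agrees by computation with the values
    -- of `S₁` to `S₆`.
    ≡⟨ combine (+ N) (f 1) (f N) (f (suc N)) (g 1) (g 2) (g (suc N)) (g (2 ℕ.+ N)) (u (suc N)) (d (suc N))
         (u (2 ℕ.* suc N)) (d (2 ℕ.* suc N)) f-top g-end u-valley d-peak*d-valley u-peak*u-valley ⟨
  _ ≡⟨ cong₂ _+_ (cong₂ _+_ (cong₂ _+_ (cong₂ _+_ (cong₂ _-_ S₁ (cong (+ N *_) S₂)) S₃) S₄) S₅) S₆ ⟨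
  _ ∎
  where
  open Fence (suc N)
  open Boundary (suc N) 2≤a I
  open Sums N 1≤N I
  open ≡-Reasoning
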